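{- Let $w\in\mathfrak{S}_n$ with a fixed reduced expression $w=s_1\cdots s_k$. If the map $\phi:\mathcal{C}^\downarrow\to[e,w]$, $\phi(C)=p(C)w$, is surjective, then $w$ avoids the patterns $4231$, $35142$, $42513$ and $351624$.
   Context: Permutations act on the right on $[n]$ and $uw$ means "first $u$, then $w$". $\mathfrak{S}_n$ is a Coxeter group with $S$ the adjacent transpositions and $T$ the set of all transpositions. $\mathfrak{S}_n$ acts on $V=\{x\in\mathbb{R}^n:\sum x_i=0\}$ by permuting coordinates; $(i\ j)$ is the reflection through $x_i=x_j$. Bruhat order: $u\le w$ iff some reduced expression of $w$ contains a subword expressing $u$; $[e,w]=\{u:u\le w\}$. Put $t_i=s_1\cdots s_{i-1}s_is_{i-1}\cdots s_1$, $H_i$ its reflecting hyperplane, $\mathcal{A}_w=\{H_1,\dots,H_k\}$ ordered $H_1>\cdots>H_k$. $L_w$: intersections of subsets of $\mathcal{A}_w$ ($\hat0=V$) ordered by reverse inclusion, covering $\lhd$; $\lambda(A\lhd B)=\min\{H\in\mathcal{A}_w:H\supseteq B,H\not\supseteq A\}$. $\mathcal{C}^\downarrow$: saturated chains $\hat0=X_0\lhd\cdots\lhd X_m$ with strictly decreasing labels $\lambda(X_{i-1}\lhd X_i)$. With $\lambda(X_{i-1}\lhd X_i)=H_{j_i}$, $p(C)=t_{j_1}\cdots t_{j_m}$. Pattern avoidance: for $p\in\mathfrak{S}_m$ in one-line notation, $w$ avoids $p$ if there are no $i_1<\cdots<i_m$ with $i_aw<i_bw\iff ap<bp$ for all $a,b$.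 -}

module Defs where

open import Data.Nat public using (ℕ; zero; suc; _∸_)
open import Data.Fin as F using (Fin; toℕ; inject₁)
open import Data.Fin.Permutation using (Permutation′; _∘ₚ_; transpose; _⟨$⟩ʳ_; _≈_)
  renaming (id to idₚ)
open import Data.Fin.Subset using (Subset; ⊥; _∈_)
open import Data.List using (List; []; _∷_; length; take; reverse; allFin; map; foldr)
open import Data.List.Relation.Binary.Sublist.Propositional using (_⊆_)
open import Data.Rational using (ℚ; 0ℚ; _+_)
open import Data.Product using (Σ; _×_; ∃; ∃-syntax)
open import Relation.Binary.PropositionalEquality using (_≡_)
open import Relation.Nullary using (¬_)
open import Function.Bundles using (_⇔_)
import Data.Nat as N
import Data.Vec as V
open import Data.Fin using (#_)

-- The symmetric group S_n : permutations of Fin n (= [n], 0-indexed).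
-- Permutations act on the right: i·w = w ⟨$⟩ʳ i, and  u ∘ₚ w  is
-- "first u, then w", i.e. the product uw of the paper.

Perm : ℕ → Set
Perm = Permutation′

-- Adjacent transposition s_i (i = 0,…,n-2 here, i.e. s_{i+1} of the paper)
-- swapping i and i+1.
adj : (n : ℕ) → Fin (n ∸ 1) → Perm n
adj zero ()
adj (suc m) i = transpose (inject₁ i) (F.suc i)

Word : ℕ → Set
Word n = List (Fin (n ∸ 1))

prod : (n : ℕ) → Word n → Perm n
prod n []       = idₚ
prod n (a ∷ as) = adj n a ∘ₚ prod n as

Reduced : (n : ℕ) → Word n → Set
Reduced n ws = (vs : Word n) → prod n vs ≈ prod n ws → length ws N.≤ length vs

Bruhat≤ : (n : ℕ) → Perm n → Perm n → Set
Bruhat≤ n u w = Σ (Word n) λ ws → Reduced n ws × prod n ws ≈ w ×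
                 Σ (Word n) λ vs → vs ⊆ ws × prod n vs ≈ u

-- The reflections t_j of a fixed word ws = s_{a1} ⋯ s_{ak}
-- (index j : Fin k is 0-based, so t j is t_{j+1} of the paper):
--   t_{j+1} = s_{a1} ⋯ s_{aj} s_{a(j+1)} s_{aj} ⋯ s_{a1}.

lookupW : (n : ℕ) (ws : Word n) → Fin (length ws) → Fin (n ∸ 1)
lookupW n (a ∷ as) F.zero    = a
lookupW n (a ∷ as) (F.suc j) = lookupW n as j

refl-t : (n : ℕ) (ws : Word n) → Fin (length ws) → Perm n
refl-t n ws j = prod n (take (toℕ j) ws) ∘ₚ
                (adj n (lookupW n ws j) ∘ₚ prod n (reverse (take (toℕ j) ws)))

-- The space V = {x ∈ 𝕂^n : Σ x_i = 0} (with 𝕂 = ℚ) and its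
-- subsets, given as predicates on vectors x : Fin n → ℚ.

Vect : ℕ → Set
Vect n = Fin n → ℚ

sumℚ : ∀ {n} → Vect n → ℚ
sumℚ {n} x = foldr _+_ 0ℚ (map x (allFin n))

InV : ∀ {n} → Vect n → Set
InV x = sumℚ x ≡ 0ℚ

-- S_n acts on V by permuting coordinates; the reflecting hyperplane of a
-- reflection t is its fixed subspace in V:  {x ∈ V : x_{i t} = x_i ∀ i}.
Hyp : ∀ {n} → Perm n → Vect n → Set
Hyp t x = InV x × (∀ i → x (t ⟨$⟩ʳ i) ≡ x i)

H : (n : ℕ) (ws : Word n) → Fin (length ws) → Vect n → Set
H n ws j = Hyp (refl-t n ws j)

-- Elements of L_w: intersections of subsets of A_w (empty intersection = V),
-- the subset given by J.
Flat : (n : ℕ) (ws : Word n) → Subset (length ws) → Vect n → Set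
Flat n ws J x = InV x × (∀ j → j ∈ J → H n ws j x)

_⊑_ : ∀ {n} → (Vect n → Set) → (Vect n → Set) → Set
X ⊑ Y = ∀ x → X x → Y x

_⊏_ : ∀ {n} → (Vect n → Set) → (Vect n → Set) → Set
X ⊏ Y = X ⊑ Y × ¬ (Y ⊑ X)

-- Covering relation A ⋖ B in L_w (order = reverse inclusion):
-- B ⊊ A and no element X of L_w with B ⊊ X ⊊ A.
Covers : (n : ℕ) (ws : Word n) → Subset (length ws) → Subset (length ws) → Set
Covers n ws A B =
  (Flat n ws B ⊏ Flat n ws A) ×
  ((K : Subset (length ws)) → ¬ ((Flat n ws B ⊏ Flat n ws K) × (Flat n ws K ⊏ Flat n ws A)))

Sep : (n : ℕ) (ws : Word n) → Subset (length ws) → Subset (length ws) →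
      Fin (length ws) → Set
Sep n ws A B j = (Flat n ws B ⊑ H n ws j) × ¬ (Flat n ws A ⊑ H n ws j)

-- λ(A ⋖ B) = H_j: the minimum, for the order H_1 > ⋯ > H_k (i.e. the one with
-- largest index), among hyperplanes of A_w containing B but not A.
IsLabel : (n : ℕ) (ws : Word n) → Subset (length ws) → Subset (length ws) →
          Fin (length ws) → Set
IsLabel n ws A B j = Sep n ws A B j × (∀ j′ → toℕ j N.< toℕ j′ → ¬ Sep n ws A B j′)

-- DecChain n ws A b p : there is a saturated chain  A = X_0 ⋖ X_1 ⋖ ⋯ ⋖ X_m
-- in L_w (m ≥ 0) whose labels λ(X_{i-1} ⋖ X_i) = H_{j_i} are strictly
-- decreasing (j_1 < j_2 < ⋯ < j_m), with b ≤ j_1, and p = t_{j_1} ⋯ t_{j_m}.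
data DecChain (n : ℕ) (ws : Word n) :
       Subset (length ws) → ℕ → Perm n → Set where
  done : ∀ {A b} → DecChain n ws A b idₚ
  step : ∀ {A b p} (B : Subset (length ws)) (j : Fin (length ws)) →
         b N.≤ toℕ j →
         Covers n ws A B →
         IsLabel n ws A B j →
         DecChain n ws B (suc (toℕ j)) p →
         DecChain n ws A b (refl-t n ws j ∘ₚ p)

-- φ : C↓ → [e,w], C ↦ p(C) w, is surjective (chains start at 0̂ = V = Flat ⊥).
PhiSurjective : (n : ℕ) (ws : Word n) → Set
PhiSurjective n ws =
  (u : Perm n) → Bruhat≤ n u (prod n ws) →
  Σ (Perm n) λ p → DecChain n ws ⊥ 0 p × ((p ∘ₚ prod n ws) ≈ u)

-- Pattern avoidance (0-indexed one-line notation: p is given by a ↦ a p).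

Contains : ∀ {n m} → Perm n → (Fin m → Fin m) → Set
Contains {n} {m} w p =
  Σ (Fin m → Fin n) λ i →
    (∀ a b → a F.< b → i a F.< i b) ×
    (∀ a b → ((w ⟨$⟩ʳ i a) F.< (w ⟨$⟩ʳ i b)) ⇔ (p a F.< p b))

Avoids : ∀ {n m} → Perm n → (Fin m → Fin m) → Set
Avoids w p = ¬ Contains w p

-- The four patterns, written 0-indexed (entry k means k+1 in the paper):
-- 4231, 35142, 42513, 351624.
p4231 : Fin 4 → Fin 4
p4231 = V.lookup (# 3 V.∷ # 1 V.∷ # 2 V.∷ # 0 V.∷ V.[])

p35142 : Fin 5 → Fin 5
p35142 = V.lookup (# 2 V.∷ # 4 V.∷ # 0 V.∷ # 3 V.∷ # 1 V.∷ V.[])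

p42513 : Fin 5 → Fin 5
p42513 = V.lookup (# 3 V.∷ # 1 V.∷ # 4 V.∷ # 0 V.∷ # 2 V.∷ V.[])

p351624 : Fin 6 → Fin 6
p351624 = V.lookup (# 2 V.∷ # 4 V.∷ # 0 V.∷ # 5 V.∷ # 1 V.∷ # 3 V.∷ V.[])

{-# OPTIONS --safe #-}

-- A chain C ∈ C↓ with p(C) = p cuts out independent hyperplanes, so every
-- vector fixed by p is fixed by all reflections in the factorization p(C):
-- each of them is an inversion of w moving points only inside a cycle of p.
-- For each pattern we exhibit u ≤ w such that some cycle of p = u w⁻¹ is not
-- connected by the inversions of w it contains; such a u is not in the image.
-- On the positions of the pattern, w and u are
--   4231 → 1324,  35142 → 12435,  42513 → 13245,  351624 → 124356.

module Submission where

open import Defs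
open import Data.Nat as ℕ using (s<s)
import Data.Nat.Properties as ℕₚ
open import Data.Nat.GeneralisedArithmetic using (fold)
open import Data.Fin as F using (Fin; toℕ; inject₁; #_)
open import Data.Fin.Properties as Fₚ using (_≟_; _<?_; all?; any?)
open import Data.Fin.Permutation using (Permutation′; _⟨$⟩ʳ_)
import Data.Fin.Permutation as Perm
open import Data.Fin.Permutation.Components using (transpose; transpose-inverse)
open import Data.List using (List; []; _∷_; _∷ʳ_; length; take; reverse; map)
open import Data.List.Properties using (unfold-reverse)
open import Data.List.Relation.Binary.Sublist.Propositional
  using (_⊆_; ⊆-refl; ⊆-trans) renaming (_∷_ to _∷ˢ_; _∷ʳ_ to _∷ʳˢ_)
open import Data.Product using (Σ; ∃; ∃₂; _×_; _,_; proj₁; proj₂)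
import Data.Product as Product
open import Data.Rational.Properties using () renaming (_≟_ to _≟ℚ_)
open import Data.Sum using (_⊎_; inj₁; inj₂)
open import Data.Unit using (⊤; tt)
import Data.Vec as V
open import Function using (_∘_; id; Injective)
open import Function.Bundles using (_⇔_; module Equivalence)
open import Relation.Binary using (DecidableEquality; tri<; tri≈; tri>)
open import Relation.Binary.PropositionalEquality
open import Relation.Nullary using (¬_; Dec; yes; no; contradiction)
open import Relation.Nullary.Decidable using (from-yes; decidable-stable; _×-dec_; _→-dec_)

open ≡-Reasoning

private
  variable
    m n : ℕ

Fixes : ∀ {ℓ} {A : Set ℓ} → (Fin n → A) → (Fin n → Fin n) → Set ℓ
Fixes x f = ∀ k → x (f k) ≡ x k

-- Transpositions

transpose-left : (a b : Fin n) → transpose a b a ≡ b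
transpose-left a b with a ≟ a
... | yes _   = refl
... | no  a≢a = contradiction refl a≢a

transpose-right : (a b : Fin n) → transpose a b b ≡ a
transpose-right a b with b ≟ a
... | yes b≡a = b≡a
... | no  _ with b ≟ b
...   | yes _   = refl
...   | no  b≢b = contradiction refl b≢b

transpose-other : {a b k : Fin n} → k ≢ a → k ≢ b → transpose a b k ≡ k
transpose-other {a = a} {b} {k} k≢a k≢b with k ≟ a
... | yes k≡a = contradiction k≡a k≢a
... | no  _ with k ≟ b
...   | yes k≡b = contradiction k≡b k≢b
...   | no  _   = refl

data TransposeView (a b k : Fin n) : Set where
  left  : k ≡ a → TransposeView a b k
  right : k ≡ b → TransposeView a b k
  other : k ≢ a → k ≢ b → TransposeView a b k

transposeView : (a b k : Fin n) → TransposeView a b k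
transposeView a b k with k ≟ a | k ≟ b
... | yes k≡a | _       = left k≡a
... | no  _   | yes k≡b = right k≡b
... | no  k≢a | no  k≢b = other k≢a k≢b

transpose-comm : (a b k : Fin n) → transpose a b k ≡ transpose b a k
transpose-comm a b k with transposeView a b k
... | left refl  = trans (transpose-left a b) (sym (transpose-right b a))
... | right refl = trans (transpose-right a b) (sym (transpose-left b a))
... | other p q  = trans (transpose-other p q) (sym (transpose-other q p))

transpose-involutive : (a b k : Fin n) → transpose a b (transpose a b k) ≡ k
transpose-involutive a b k =
  trans (transpose-comm a b (transpose a b k)) (transpose-inverse b a {k})

transpose-map : {f : Fin m → Fin n} → Injective _≡_ _≡_ f → (a b k : Fin m) →
                f (transpose a b k) ≡ transpose (f a) (f b) (f k)
transpose-map {f = f} inj a b k with transposeView a b k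
... | left refl  = trans (cong f (transpose-left a b)) (sym (transpose-left (f a) (f b)))
... | right refl = trans (cong f (transpose-right a b)) (sym (transpose-right (f a) (f b)))
... | other p q  = trans (cong f (transpose-other p q))
                         (sym (transpose-other (p ∘ inj) (q ∘ inj)))

≡⇒Fixes-transpose : ∀ {ℓ} {A : Set ℓ} (x : Fin n → A) {a b} →
                    x a ≡ x b → Fixes x (transpose a b)
≡⇒Fixes-transpose x {a} {b} eq k with transposeView a b k
... | left refl  = trans (cong x (transpose-left a b)) (sym eq)
... | right refl = trans (cong x (transpose-right a b)) eq
... | other p q  = cong x (transpose-other p q)

⟨$⟩ʳ-injective : (π : Permutation′ n) → Injective _≡_ _≡_ (π ⟨$⟩ʳ_)
⟨$⟩ʳ-injective π eq =
  trans (sym (Perm.inverseˡ π)) (trans (cong (π Perm.⟨$⟩ˡ_) eq) (Perm.inverseˡ π))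

-- Orbits

-- Two of the first iterates coincide by pigeonhole. Injectivity cancels `q` from both sides until
-- the earlier iterate is `b` itself.
orbit-returns : {q : Fin n → Fin n} → Injective _≡_ _≡_ q →
                ∀ b → ∃ λ r → fold b q (suc r) ≡ b
orbit-returns {n} {q} inj b with Fₚ.pigeonhole (ℕₚ.n<1+n n) (fold b q ∘ toℕ)
... | i , j , i<j , eq = peel (toℕ i) (toℕ j) i<j eq
  where
  peel : ∀ i j → i ℕ.< j → fold b q i ≡ fold b q j → ∃ λ r → fold b q (suc r) ≡ b
  peel zero    (suc j) _         eq = j , sym eq
  peel (suc i) (suc j) (s<s i<j) eq = peel i j i<j (inj eq)

-- If the q-orbit of b avoided a, then following it from b until the step
-- returning to b would give x b ≡ x a.
fixed-separates : ∀ {ℓ₁ ℓ₂} {A : Set ℓ₁} {B : Set ℓ₂} → DecidableEquality B →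
  {q : Fin n → Fin n} → Injective _≡_ _≡_ q →
  {a b : Fin n} {x : Fin n → A} {y : Fin n → B} →
  Fixes x (transpose a b ∘ q) → x a ≢ x b → Fixes y q → y a ≡ y b
fixed-separates _≟B_ {q} inj {a} {b} {x} {y} fix-x xa≢xb fix-y =
  decidable-stable (y a ≟B y b) λ ya≢yb →
  let r , qʳb≡b = orbit-returns inj b in xa≢xb (begin
    x a                                  ≡⟨ cong x (transpose-right a b) ⟨
    x (transpose a b b)                  ≡⟨ cong (x ∘ transpose a b) qʳb≡b ⟨
    x (transpose a b (fold b q (suc r))) ≡⟨ fix-x _ ⟩
    x (fold b q r)                       ≡⟨ x-const ya≢yb r ⟩
    x b                                  ∎)
  where
  y-const : ∀ i → y (fold b q i) ≡ y b
  y-const zero    = refl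
  y-const (suc i) = trans (fix-y _) (y-const i)

  x-const : y a ≢ y b → ∀ i → x (fold b q i) ≡ x b
  x-const ya≢yb zero    = refl
  x-const ya≢yb (suc i) with transposeView a b (fold b q (suc i))
  -- `y` has the value `y b` on the whole orbit, so meeting `a` would give `y a ≡ y b`.
  ... | left eq   = contradiction (trans (cong y (sym eq)) (y-const (suc i))) ya≢yb
  ... | right eq  = cong x eq
  ... | other p r = begin
    x (fold b q (suc i))                 ≡⟨ cong x (transpose-other p r) ⟨
    x (transpose a b (fold b q (suc i))) ≡⟨ fix-x _ ⟩
    x (fold b q i)                       ≡⟨ x-const ya≢yb i ⟩
    x b                                  ∎

-- Words

adj-involutive : (s : Fin (n ∸ 1)) (k : Fin n) → adj n s ⟨$⟩ʳ (adj n s ⟨$⟩ʳ k) ≡ k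
adj-involutive {suc n} s k = transpose-involutive (inject₁ s) (F.suc s) k

-- No index lies strictly between `p` and `q`, so any third index is on the same side of both; only
-- the pair `p`, `q` itself can change its order.
transpose-consecutive : (p q : Fin n) → toℕ q ≡ suc (toℕ p) → {a b : Fin n} → a F.< b →
  transpose p q a F.< transpose p q b ⊎ (a ≡ p × b ≡ q)
transpose-consecutive p q q≡1+p {a} {b} a<b
  with transposeView p q a | transposeView p q b
... | left a≡p  | right b≡q = inj₂ (a≡p , b≡q)
... | left refl | left refl = contradiction a<b (ℕₚ.<-irrefl refl)
... | left refl | other b≢p b≢q
    rewrite transpose-left p q | transpose-other b≢p b≢q =
      inj₁ (ℕₚ.≤∧≢⇒< (subst (ℕ._≤ toℕ b) (sym q≡1+p) a<b) (b≢q ∘ sym ∘ Fₚ.toℕ-injective))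
... | right refl | left refl =
      contradiction (subst (ℕ._< toℕ p) q≡1+p a<b) (ℕₚ.<-asym (ℕₚ.n<1+n _))
... | right refl | right refl = contradiction a<b (ℕₚ.<-irrefl refl)
... | right refl | other b≢p b≢q
    rewrite transpose-right p q | transpose-other b≢p b≢q =
      inj₁ (ℕₚ.<-trans (subst (toℕ p ℕ.<_) (sym q≡1+p) (ℕₚ.n<1+n _)) a<b)
... | other a≢p a≢q | left refl
    rewrite transpose-left p q | transpose-other a≢p a≢q =
      inj₁ (ℕₚ.<-trans a<b (subst (toℕ p ℕ.<_) (sym q≡1+p) (ℕₚ.n<1+n _)))
... | other a≢p a≢q | right refl
    rewrite transpose-right p q | transpose-other a≢p a≢q =
      inj₁ (ℕₚ.≤∧≢⇒< (ℕ.s≤s⁻¹ (subst (toℕ a ℕ.<_) q≡1+p a<b)) (a≢p ∘ Fₚ.toℕ-injective))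
... | other a≢p a≢q | other b≢p b≢q
    rewrite transpose-other a≢p a≢q | transpose-other b≢p b≢q = inj₁ a<b

adj-order : (s : Fin (n ∸ 1)) {a b : Fin n} → a F.< b →
  (adj n s ⟨$⟩ʳ a) F.< (adj n s ⟨$⟩ʳ b) ⊎ (∀ k → adj n s ⟨$⟩ʳ k ≡ transpose a b k)
adj-order {suc n} s a<b
  with transpose-consecutive (inject₁ s) (F.suc s) (cong suc (sym (Fₚ.toℕ-inject₁ s))) a<b
... | inj₁ lt            = inj₁ lt
... | inj₂ (refl , refl) = inj₂ λ _ → refl

-- Inversions and the strong exchange condition.

Inversion : (Fin n → Fin m) → Fin n → Fin n → Set
Inversion f a b = a F.< b × f b F.< f a

-- The pair is carried through the letters. As the whole word reverses its order, some letter must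
-- swap exactly this pair; deleting that letter has the effect of applying the transposition of `a`
-- and `b` first.
strong-exchange : (ws : Word n) {a b : Fin n} → Inversion (prod n ws ⟨$⟩ʳ_) a b →
  Σ (Word n) λ vs → vs ⊆ ws × suc (length vs) ≡ length ws ×
    ∀ k → prod n vs ⟨$⟩ʳ k ≡ prod n ws ⟨$⟩ʳ transpose a b k
strong-exchange [] (a<b , b<a) = contradiction a<b (ℕₚ.<-asym b<a)
strong-exchange {n} (s ∷ ws) {a} {b} (a<b , wb<wa) with adj-order s a<b
... | inj₂ s≗τ = ws , s ∷ʳˢ ⊆-refl , refl , λ k → cong (prod n ws ⟨$⟩ʳ_) (begin
        k                                     ≡⟨ adj-involutive s k ⟨
        adj n s ⟨$⟩ʳ (adj n s ⟨$⟩ʳ k)          ≡⟨ cong (adj n s ⟨$⟩ʳ_) (s≗τ k) ⟩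
        adj n s ⟨$⟩ʳ transpose a b k           ∎)
... | inj₁ sa<sb with strong-exchange ws (sa<sb , wb<wa)
...   | vs , vs⊆ws , len , eq = s ∷ vs , refl ∷ˢ vs⊆ws , cong suc len , λ k →
        trans (eq _) (cong (prod n ws ⟨$⟩ʳ_)
          (sym (transpose-map (⟨$⟩ʳ-injective (adj n s)) a b k)))

-- The reflections attached to a word.

prod-∷ʳ : (ws : Word n) (s : Fin (n ∸ 1)) (k : Fin n) →
          prod n (ws ∷ʳ s) ⟨$⟩ʳ k ≡ adj n s ⟨$⟩ʳ (prod n ws ⟨$⟩ʳ k)
prod-∷ʳ []       s k = refl
prod-∷ʳ (_ ∷ ws) s k = prod-∷ʳ ws s _

-- Turns the definition by prefixes into a recursion on the word: the prefix begins with `s` and its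
-- reversal ends with `s`, whence a conjugation.
refl-t-suc : (s : Fin (n ∸ 1)) (ws : Word n) (j : Fin (length ws)) (k : Fin n) →
  refl-t n (s ∷ ws) (F.suc j) ⟨$⟩ʳ k ≡ adj n s ⟨$⟩ʳ (refl-t n ws j ⟨$⟩ʳ (adj n s ⟨$⟩ʳ k))
refl-t-suc {n} s ws j k
  rewrite unfold-reverse s (take (toℕ j) ws) = prod-∷ʳ (reverse (take (toℕ j) ws)) s _

adj-transpose : (s : Fin (n ∸ 1)) → ∃₂ λ a b → a ≢ b × ∀ k → adj n s ⟨$⟩ʳ k ≡ transpose a b k
adj-transpose {suc n} s = inject₁ s , F.suc s ,
  (λ eq → ℕₚ.m≢1+m+n (toℕ s) (trans (sym (Fₚ.toℕ-inject₁ s))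
            (trans (cong toℕ eq) (cong suc (sym (ℕₚ.+-identityʳ _)))))) ,
  λ _ → refl

-- Conjugating a transposition by `adj n s` gives the transposition of the images, so the shape
-- survives each step of the recursion.
refl-t-transpose : (ws : Word n) (j : Fin (length ws)) →
  ∃₂ λ a b → a ≢ b × ∀ k → refl-t n ws j ⟨$⟩ʳ k ≡ transpose a b k
refl-t-transpose (s ∷ ws) F.zero = adj-transpose s
refl-t-transpose {n} (s ∷ ws) (F.suc j) with refl-t-transpose ws j
... | a , b , a≢b , eq = σ a , σ b , a≢b ∘ ⟨$⟩ʳ-injective (adj n s) , λ k → begin
    refl-t n (s ∷ ws) (F.suc j) ⟨$⟩ʳ k          ≡⟨ refl-t-suc s ws j k ⟩
    σ (refl-t n ws j ⟨$⟩ʳ σ k)                  ≡⟨ cong σ (eq (σ k)) ⟩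
    σ (transpose a b (σ k))                    ≡⟨ transpose-map (⟨$⟩ʳ-injective (adj n s)) a b (σ k) ⟩
    transpose (σ a) (σ b) (σ (σ k))            ≡⟨ cong (transpose (σ a) (σ b)) (adj-involutive s k) ⟩
    transpose (σ a) (σ b) k                    ∎
  where σ = adj n s ⟨$⟩ʳ_

refl-t-transpose< : (ws : Word n) (j : Fin (length ws)) →
  ∃₂ λ a b → a F.< b × ∀ k → refl-t n ws j ⟨$⟩ʳ k ≡ transpose a b k
refl-t-transpose< ws j with refl-t-transpose ws j
... | a , b , a≢b , eq with Fₚ.<-cmp a b
...   | tri< a<b _ _ = a , b , a<b , eq
...   | tri≈ _ a≡b _ = contradiction a≡b a≢b
...   | tri> _ _ b<a = b , a , b<a , λ k → trans (eq k) (transpose-comm a b k)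

-- In the product of `refl-t n ws j` and the word, the reversed prefix cancels the prefix of the
-- word and the letter at `j` then cancels its own copy. What remains is the word without that
-- letter.
delete-letter : (ws : Word n) (j : Fin (length ws)) →
  Σ (Word n) λ vs → suc (length vs) ≡ length ws ×
    ∀ k → prod n vs ⟨$⟩ʳ k ≡ prod n ws ⟨$⟩ʳ (refl-t n ws j ⟨$⟩ʳ k)
delete-letter {n} (s ∷ ws) F.zero =
  ws , refl , λ k → cong (prod n ws ⟨$⟩ʳ_) (sym (adj-involutive s k))
delete-letter {n} (s ∷ ws) (F.suc j) with delete-letter ws j
... | vs , len , eq = s ∷ vs , cong suc len , λ k →
  trans (eq _) (cong (prod n ws ⟨$⟩ʳ_)
    (trans (sym (adj-involutive s _)) (cong (adj n s ⟨$⟩ʳ_) (sym (refl-t-suc s ws j k)))))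

-- Otherwise t_j would be an inversion of t_j w, and exchanging twice would give
-- an expression of w with two letters fewer.
refl-t-inversion : (ws : Word n) → Reduced n ws → (j : Fin (length ws)) →
  ∃₂ λ a b → Inversion (prod n ws ⟨$⟩ʳ_) a b × ∀ k → refl-t n ws j ⟨$⟩ʳ k ≡ transpose a b k
refl-t-inversion {n} ws red j with refl-t-transpose< ws j
... | a , b , a<b , t≗τ with Fₚ.<-cmp (prod n ws ⟨$⟩ʳ b) (prod n ws ⟨$⟩ʳ a)
...   | tri< wb<wa _ _ = a , b , (a<b , wb<wa) , t≗τ
...   | tri≈ _ wb≡wa _ =
        contradiction a<b (ℕₚ.<-irrefl (cong toℕ (sym (⟨$⟩ʳ-injective (prod n ws) wb≡wa))))
...   | tri> _ _ wa<wb with delete-letter ws j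
...     | vs , len , vs≗ with strong-exchange vs (a<b , subst₂ F._<_ (sym vb≡wa) (sym va≡wb) wa<wb)
  where
  w = prod n ws ⟨$⟩ʳ_
  va≡wb : prod n vs ⟨$⟩ʳ a ≡ w b
  va≡wb = trans (vs≗ a) (cong w (trans (t≗τ a) (transpose-left a b)))
  vb≡wa : prod n vs ⟨$⟩ʳ b ≡ w a
  vb≡wa = trans (vs≗ b) (cong w (trans (t≗τ b) (transpose-right a b)))
...       | us , _ , len′ , us≗ = contradiction (red us us≗w) (ℕₚ.<⇒≱ us<ws)
  where
  us≗w : ∀ k → prod n us ⟨$⟩ʳ k ≡ prod n ws ⟨$⟩ʳ k
  us≗w k = begin
    prod n us ⟨$⟩ʳ k                                           ≡⟨ us≗ k ⟩
    prod n vs ⟨$⟩ʳ transpose a b k                             ≡⟨ vs≗ _ ⟩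
    prod n ws ⟨$⟩ʳ (refl-t n ws j ⟨$⟩ʳ transpose a b k)        ≡⟨ cong (prod n ws ⟨$⟩ʳ_) (t≗τ _) ⟩
    prod n ws ⟨$⟩ʳ transpose a b (transpose a b k)             ≡⟨ cong (prod n ws ⟨$⟩ʳ_) (transpose-involutive a b k) ⟩
    prod n ws ⟨$⟩ʳ k                                           ∎
  us<ws : length us ℕ.< length ws
  us<ws = ℕₚ.≤-trans (ℕₚ.≤-reflexive len′) (ℕₚ.≤-trans (ℕₚ.n≤1+n _) (ℕₚ.≤-reflexive len))

-- Chains

-- q is the product of the reflections read before reaching A.
chain-fixes : (ws : Word n) {x z : Fin n → Fin n} →
  (∀ j → Fixes x (refl-t n ws j ⟨$⟩ʳ_) → Fixes z (refl-t n ws j ⟨$⟩ʳ_)) →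
  ∀ {A b p} → DecChain n ws A b p →
  (q : Fin n → Fin n) → Injective _≡_ _≡_ q → (∀ y → Flat n ws A y → Fixes y q) →
  Fixes x ((p ⟨$⟩ʳ_) ∘ q) → Fixes x q × Fixes z (p ⟨$⟩ʳ_)
chain-fixes ws x⇒z done q inj A-fixes x-fixes = x-fixes , λ _ → refl
chain-fixes {n} ws {x} {z} x⇒z {A} (step {p = p} B j _ ((B⊑A , _) , _) ((B⊑Hj , A⋢Hj) , _) C)
            q inj A-fixes x-fixes =
  x-fixes-q , λ k → trans (proj₂ IH _) (x⇒z j x-fixes-t k)
  where
  t = refl-t n ws j ⟨$⟩ʳ_

  B-fixes : ∀ y → Flat n ws B y → Fixes y (t ∘ q)
  B-fixes y y∈B k = trans (proj₂ (B⊑Hj y y∈B) (q k)) (A-fixes y (B⊑A y y∈B) k)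

  IH : Fixes x (t ∘ q) × Fixes z (p ⟨$⟩ʳ_)
  -- `x` is known to be fixed only by the full product, so the recursion first runs to the end of
  -- the chain; one reflection is stripped off on each return.
  IH = chain-fixes ws x⇒z C (t ∘ q) (inj ∘ ⟨$⟩ʳ-injective (refl-t n ws j)) B-fixes x-fixes

  x-fixes-t : Fixes x t
  x-fixes-t with refl-t-transpose ws j
  ... | a , b , _ , t≗τ = λ k → trans (cong x (t≗τ k)) (≡⇒Fixes-transpose x xa≡xb k)
    where
    xa≡xb : x a ≡ x b
    -- If `x` separated `a` from `b`, they would share a cycle of `q`. Every vector of the flat `A`
    -- is fixed by `q`, so `A` would lie in the hyperplane of index `j`, against the choice of the
    -- label.
    xa≡xb = decidable-stable (x a ≟ x b) λ xa≢xb → A⋢Hj λ y y∈A →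
      proj₁ y∈A , λ k → trans (cong y (t≗τ k)) (≡⇒Fixes-transpose y
        (fixed-separates _≟ℚ_ inj
          (λ i → trans (cong x (sym (t≗τ (q i)))) (proj₁ IH i)) xa≢xb (A-fixes y y∈A)) k)

  x-fixes-q : Fixes x q
  x-fixes-q k = trans (sym (x-fixes-t (q k))) (proj₁ IH k)

-- Patterns

-- The head acts last, next to the permutation composed after it; this matches the passage from `p`
-- to `p ∘ transpose a b` in `Descends`.
swaps : List (Fin n × Fin n) → Fin n → Fin n
swaps []            k = k
swaps ((a , b) ∷ L) k = transpose a b (swaps L k)

-- A descending path in the Bruhat graph from `p` to `p ∘ swaps L`.
Descends : (Fin m → Fin m) → List (Fin m × Fin m) → Set
Descends p []            = ⊤
Descends p ((a , b) ∷ L) = Inversion p a b × Descends (p ∘ transpose a b) L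

descends? : (p : Fin m → Fin m) (L : List (Fin m × Fin m)) → Dec (Descends p L)
descends? p []            = yes tt
descends? p ((a , b) ∷ L) = ((a <? b) ×-dec (p b <? p a)) ×-dec descends? (p ∘ transpose a b) L

-- r is constant on the cycles of swaps L (that is, of u w⁻¹), and r′ is constant
-- on the connected components of the inversion graph inside the classes of r.
record Obstruction (p : Fin m → Fin m) : Set where
  field
    L        : List (Fin m × Fin m)
    descends : Descends p L
    r r′     : Fin m → Fin m
    r-fixes  : Fixes r (swaps L)
    r⇒r′     : ∀ a b → Inversion p a b → r a ≡ r b → r′ a ≡ r′ b
    moved    : Fin m
    r′-moved : r′ (swaps L moved) ≢ r′ moved

-- Transport along an occurrence of a pattern.

module _ {i : Fin m → Fin n} (i-mono : ∀ a b → a F.< b → i a F.< i b) where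

  mono⇒injective : Injective _≡_ _≡_ i
  mono⇒injective {a} {b} ia≡ib with Fₚ.<-cmp a b
  ... | tri< a<b _ _ = contradiction (i-mono a b a<b) (ℕₚ.<-irrefl (cong toℕ ia≡ib))
  ... | tri≈ _ a≡b _ = a≡b
  ... | tri> _ _ b<a = contradiction (i-mono b a b<a) (ℕₚ.<-irrefl (cong toℕ (sym ia≡ib)))

  mono-reflects : ∀ a b → i a F.< i b → a F.< b
  mono-reflects a b ia<ib with Fₚ.<-cmp a b
  ... | tri< a<b _ _  = a<b
  ... | tri≈ _ refl _ = contradiction ia<ib (ℕₚ.<-irrefl refl)
  ... | tri> _ _ b<a  = contradiction ia<ib (ℕₚ.<-asym (i-mono b a b<a))

  -- An inversion of the pattern is an inversion of the permutation at the chosen positions, so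
  -- strong exchange applies. Afterwards these positions carry `p ∘ transpose a b`, and the descent
  -- continues inside the shorter subword.
  descends⇒subword : (ws : Word n) {p : Fin m → Fin m} →
    (∀ a b → ((prod n ws ⟨$⟩ʳ i a) F.< (prod n ws ⟨$⟩ʳ i b)) ⇔ (p a F.< p b)) →
    (L : List (Fin m × Fin m)) → Descends p L →
    Σ (Word n) λ vs → vs ⊆ ws ×
      ∀ k → prod n vs ⟨$⟩ʳ k ≡ prod n ws ⟨$⟩ʳ swaps (map (Product.map i i) L) k
  descends⇒subword ws iso [] _ = ws , ⊆-refl , λ _ → refl
  descends⇒subword ws {p} iso ((a , b) ∷ L) ((a<b , pb<pa) , desc)
    with strong-exchange ws (i-mono a b a<b , Equivalence.from (iso b a) pb<pa)
  ... | vs , vs⊆ws , _ , vs≗ with descends⇒subword vs iso′ L desc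
    where
    shift : ∀ c → prod n vs ⟨$⟩ʳ i c ≡ prod n ws ⟨$⟩ʳ i (transpose a b c)
    shift c = trans (vs≗ (i c))
      (cong (prod n ws ⟨$⟩ʳ_) (sym (transpose-map mono⇒injective a b c)))
    iso′ : ∀ c d → ((prod n vs ⟨$⟩ʳ i c) F.< (prod n vs ⟨$⟩ʳ i d)) ⇔
                   (p (transpose a b c) F.< p (transpose a b d))
    iso′ c d rewrite shift c | shift d = iso (transpose a b c) (transpose a b d)
  ...   | us , us⊆vs , us≗ = us , ⊆-trans us⊆vs vs⊆ws , λ k → trans (us≗ k) (vs≗ _)

  -- Transports a labelling of the pattern. Each index outside the occurrence forms a class of its
  -- own, and taking the other labels in the image of `i` keeps the two kinds apart.
  extend : (Fin m → Fin m) → Fin n → Fin n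
  extend f k with any? (λ a → i a ≟ k)
  ... | yes (a , _) = i (f a)
  ... | no  _       = k

  extend-in : (f : Fin m → Fin m) (a : Fin m) → extend f (i a) ≡ i (f a)
  extend-in f a with any? (λ b → i b ≟ i a)
  ... | yes (b , ib≡ia) = cong (i ∘ f) (mono⇒injective ib≡ia)
  ... | no  ∄           = contradiction (a , refl) ∄

  extend-out : (f : Fin m → Fin m) {k : Fin n} → ¬ (∃ λ a → i a ≡ k) → extend f k ≡ k
  extend-out f {k} ∄ with any? (λ a → i a ≟ k)
  ... | yes ∃a = contradiction ∃a ∄
  ... | no  _  = refl

  swaps-in : (L : List (Fin m × Fin m)) (c : Fin m) →
             swaps (map (Product.map i i) L) (i c) ≡ i (swaps L c)
  swaps-in []            c = refl
  swaps-in ((a , b) ∷ L) c = trans (cong (transpose (i a) (i b)) (swaps-in L c))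
                                   (sym (transpose-map mono⇒injective a b (swaps L c)))

  swaps-out : (L : List (Fin m × Fin m)) {k : Fin n} → ¬ (∃ λ a → i a ≡ k) →
              swaps (map (Product.map i i) L) k ≡ k
  swaps-out []            ∄ = refl
  swaps-out ((a , b) ∷ L) ∄ =
    trans (cong (transpose (i a) (i b)) (swaps-out L ∄))
          (transpose-other (λ eq → ∄ (a , sym eq)) (λ eq → ∄ (b , sym eq)))

  extend-fixes : {r : Fin m → Fin m} (L : List (Fin m × Fin m)) → Fixes r (swaps L) →
                 Fixes (extend r) (swaps (map (Product.map i i) L))
  extend-fixes {r} L fix k with any? (λ a → i a ≟ k)
  ... | no  ∄          = trans (cong (extend r) (swaps-out L ∄)) (extend-out r ∄)
  ... | yes (a , refl) = begin
    extend r (swaps (map (Product.map i i) L) (i a)) ≡⟨ cong (extend r) (swaps-in L a) ⟩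
    extend r (i (swaps L a))                         ≡⟨ extend-in r (swaps L a) ⟩
    i (r (swaps L a))                                ≡⟨ cong i (fix a) ⟩
    i (r a)                                          ∎

  -- An index outside the occurrence shares its label with no other index, so only pairs inside
  -- matter, and there the inversions are those of the pattern.
  extend-refines : {p r r′ : Fin m → Fin m} (w : Fin n → Fin n) →
    (∀ a b → (w (i a) F.< w (i b)) ⇔ (p a F.< p b)) →
    (∀ a b → Inversion p a b → r a ≡ r b → r′ a ≡ r′ b) →
    ∀ k l → Inversion w k l → extend r k ≡ extend r l → extend r′ k ≡ extend r′ l
  extend-refines w iso r⇒r′ k l (k<l , wl<wk) eq
    with any? (λ a → i a ≟ k) | any? (λ a → i a ≟ l)
  ... | no _           | no _           = eq
  ... | no ∄           | yes (b , refl) = contradiction (_ , sym eq) ∄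
  ... | yes (a , refl) | no ∄           = contradiction (_ , eq) ∄
  ... | yes (a , refl) | yes (b , refl) =
    cong i (r⇒r′ a b (mono-reflects a b k<l , Equivalence.to (iso b a) wl<wk)
                     (mono⇒injective eq))

-- A chain over `u` has product `u w⁻¹`, which fixes `x`; hence each of its reflections fixes `x`.
-- Being inversions of `w`, they fix `z` too, and so does their product, although it moves one index
-- to a different label of `z`.
obstruction⇒avoids : {p : Fin m → Fin m} → Obstruction p →
  (ws : Word n) → Reduced n ws → PhiSurjective n ws → Avoids (prod n ws) p
obstruction⇒avoids {n = n} {p} O ws red surj (i , i-mono , iso)
  with descends⇒subword i-mono ws iso L descends
  where open Obstruction O
... | vs , vs⊆ws , vs≗ with surj (prod n vs) (ws , red , (λ _ → refl) , vs , vs⊆ws , λ _ → refl)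
... | π , chain , π≗ = r′-moved (mono⇒injective i-mono (begin
    i (r′ (swaps L moved))       ≡⟨ extend-in i-mono r′ _ ⟨
    z (i (swaps L moved))        ≡⟨ cong z (swaps-in i-mono L moved) ⟨
    z (swaps L̂ (i moved))        ≡⟨ cong z (π≗swaps (i moved)) ⟨
    z (π ⟨$⟩ʳ i moved)           ≡⟨ z-fixes (i moved) ⟩
    z (i moved)                  ≡⟨ extend-in i-mono r′ moved ⟩
    i (r′ moved)                 ∎))
  where
  open Obstruction O
  x = extend i-mono r
  z = extend i-mono r′
  L̂ = map (Product.map i i) L

  π≗swaps : ∀ k → π ⟨$⟩ʳ k ≡ swaps L̂ k
  π≗swaps k = ⟨$⟩ʳ-injective (prod n ws) (trans (π≗ k) (vs≗ k))

  x⇒z : ∀ j → Fixes x (refl-t n ws j ⟨$⟩ʳ_) → Fixes z (refl-t n ws j ⟨$⟩ʳ_)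
  x⇒z j x-fixes k with refl-t-inversion ws red j
  ... | a , b , inv , t≗τ = trans (cong z (t≗τ k)) (≡⇒Fixes-transpose z za≡zb k)
    where
    xa≡xb : x a ≡ x b
    xa≡xb = trans (sym (x-fixes a)) (cong x (trans (t≗τ a) (transpose-left a b)))
    za≡zb : z a ≡ z b
    za≡zb = extend-refines i-mono (prod n ws ⟨$⟩ʳ_) iso r⇒r′ a b inv xa≡xb

  z-fixes : Fixes z (π ⟨$⟩ʳ_)
  -- At the bottom of the chain no reflection has been read, so `q` is the identity.
  z-fixes = proj₂ (chain-fixes ws x⇒z chain id id (λ _ _ _ → refl)
    λ k → trans (cong x (π≗swaps k)) (extend-fixes i-mono L r-fixes k))

-- The certificates for the four patterns.

fixes? : (r f : Fin m → Fin m) → Dec (Fixes r f)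
fixes? r f = all? λ k → r (f k) ≟ r k

refines? : (p r r′ : Fin m → Fin m) →
           Dec (∀ a b → Inversion p a b → r a ≡ r b → r′ a ≡ r′ b)
refines? p r r′ = all? λ a → all? λ b →
  ((a <? b) ×-dec (p b <? p a)) →-dec ((r a ≟ r b) →-dec (r′ a ≟ r′ b))

obstruction4231 : Obstruction p4231
obstruction4231 = record
  { L = L ; r = r ; r′ = r′ ; moved = # 1
  ; descends = from-yes (descends? p4231 L)
  ; r-fixes  = from-yes (fixes? r (swaps L))
  ; r⇒r′     = from-yes (refines? p4231 r r′)
  ; r′-moved = λ () }
  where
  L  = (# 0 , # 1) ∷ (# 0 , # 3) ∷ (# 1 , # 2) ∷ (# 2 , # 3) ∷ []
  r  = V.lookup (# 0 V.∷ # 1 V.∷ # 1 V.∷ # 0 V.∷ V.[])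
  -- Positions 1 and 2 form a cycle but carry increasing entries, so their class splits.
  r′ = V.lookup (# 0 V.∷ # 1 V.∷ # 2 V.∷ # 0 V.∷ V.[])

obstruction35142 : Obstruction p35142
obstruction35142 = record
  { L = L ; r = r ; r′ = r′ ; moved = # 3
  ; descends = from-yes (descends? p35142 L)
  ; r-fixes  = from-yes (fixes? r (swaps L))
  ; r⇒r′     = from-yes (refines? p35142 r r′)
  ; r′-moved = λ () }
  where
  L  = (# 0 , # 2) ∷ (# 1 , # 2) ∷ (# 1 , # 4) ∷ (# 2 , # 3) ∷ (# 3 , # 4) ∷ []
  r  = V.lookup (# 0 V.∷ # 1 V.∷ # 0 V.∷ # 0 V.∷ # 1 V.∷ V.[])
  -- The cycle on positions 0, 2, 3 carries 2, 0, 3: position 3 is in no inversion there.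
  r′ = V.lookup (# 0 V.∷ # 1 V.∷ # 0 V.∷ # 3 V.∷ # 1 V.∷ V.[])

obstruction42513 : Obstruction p42513
obstruction42513 = record
  { L = L ; r = r ; r′ = r′ ; moved = # 1
  ; descends = from-yes (descends? p42513 L)
  ; r-fixes  = from-yes (fixes? r (swaps L))
  ; r⇒r′     = from-yes (refines? p42513 r r′)
  ; r′-moved = λ () }
  where
  L  = (# 0 , # 1) ∷ (# 0 , # 3) ∷ (# 1 , # 4) ∷ (# 2 , # 3) ∷ (# 3 , # 4) ∷ []
  r  = V.lookup (# 0 V.∷ # 1 V.∷ # 1 V.∷ # 0 V.∷ # 1 V.∷ V.[])
  -- The cycle on positions 1, 2, 4 carries 1, 4, 2: position 1 is in no inversion there.
  r′ = V.lookup (# 0 V.∷ # 1 V.∷ # 2 V.∷ # 0 V.∷ # 2 V.∷ V.[])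

obstruction351624 : Obstruction p351624
obstruction351624 = record
  { L = L ; r = r ; r′ = r′ ; moved = # 2
  ; descends = from-yes (descends? p351624 L)
  ; r-fixes  = from-yes (fixes? r (swaps L))
  ; r⇒r′     = from-yes (refines? p351624 r r′)
  ; r′-moved = λ () }
  where
  L  = (# 0 , # 2) ∷ (# 1 , # 2) ∷ (# 1 , # 4) ∷ (# 2 , # 5) ∷ (# 3 , # 4) ∷ (# 4 , # 5) ∷ []
  r  = V.lookup (# 0 V.∷ # 1 V.∷ # 0 V.∷ # 0 V.∷ # 1 V.∷ # 0 V.∷ V.[])
  -- The cycle on positions 0, 2, 3, 5 carries 2, 0, 5, 3, whose only inversions join 0 to 2 and 3
  -- to 5.
  r′ = V.lookup (# 0 V.∷ # 1 V.∷ # 0 V.∷ # 3 V.∷ # 1 V.∷ # 3 V.∷ V.[])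

theorem4p1 : (n : ℕ) (ws : Word n) → Reduced n ws → PhiSurjective n ws →
    Avoids (prod n ws) p4231 × Avoids (prod n ws) p35142 ×
    Avoids (prod n ws) p42513 × Avoids (prod n ws) p351624
theorem4p1 n ws red surj =
  obstruction⇒avoids obstruction4231 ws red surj ,
  obstruction⇒avoids obstruction35142 ws red surj ,
  obstruction⇒avoids obstruction42513 ws red surj ,
  obstruction⇒avoids obstruction351624 ws red surj
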